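{- Let $\sigma=\sigma(n)\in(0,1)$ satisfy $\min\{\sigma,1-\sigma\}=\Omega(1)$ and $\sigma n\in\{0,\dots,n\}$. Fix constant parameters $0\leq\varepsilon_c<\varepsilon_f\leq1$ such that $\varepsilon_f<\max\{\sigma,1-\sigma\}$. Then every $(\varepsilon_c,\varepsilon_f)$-IPP for $\mathsf{HW}_n(\sigma)$ with perfect completeness and constant soundness error, with verifier query complexity $Q_V$ and honest-prover query complexity $Q_P$, satisfies \[ Q_V+Q_P=\Omega(n). \] In particular, no such IPP is doubly sublinear.
   Context: For $x\in\{0,1\}^n$ let $\mathrm{wt}(x)=\frac1n\sum_i x_i$, and $\mathsf{HW}_n(\sigma):=\{x\in\{0,1\}^n:\mathrm{wt}(x)=\sigma\}$. $\Delta(x,\mathsf{HW}_n(\sigma))$ is the minimum relative Hamming distance from $x$ to a string in $\mathsf{HW}_n(\sigma)$. Parties access $x$ through an oracle returning $x_i$ on query $i$; all parameters are known explicitly. An $(\varepsilon_c,\varepsilon_f)$-IPP for $\mathsf{HW}_n(\sigma)$ with perfect completeness and constant soundness error consists of a probabilistic oracle verifier $V$ and a designated probabilistic honest prover $P_h$ (also having only oracle access to $x$) such that: if $\Delta(x,\mathsf{HW}_n(\sigma))\leq\varepsilon_c$ then $V$ interacting with $P_h$ accepts with probability one; if $\Delta(x,\mathsf{HW}_n(\sigma))>\varepsilon_f$ then for every (computationally unbounded, possibly knowing $x$ entirely) prover $P^*$, $V$ rejects with probability at least a positive constant. $Q_V$ is the worst-case number of oracle queries of the verifier; $Q_P$ is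 the worst-case number of oracle queries of the designated honest prover on completeness instances (those with $\Delta\le\varepsilon_c$). Doubly sublinear means that both $Q_V$ and $Q_P$ are $o(n)$. -}

module Defs where

open import Data.Bool.Base using (Bool; true; false; not; _xor_; if_then_else_)
import Data.Bool.Properties as Bool
open import Data.Fin.Base using (Fin)
open import Data.Integer.Base using (+_)
open import Data.List.Base as List using (List; []; _∷_; _++_; filter; foldr)
import Data.List.Extrema as Extrema
open import Data.Nat.Base as ℕ using (ℕ; zero; suc; NonZero)
open import Data.Product.Base using (∃; ∃-syntax; _×_; _,_)
open import Data.Rational.Base using (ℚ; _/_; 0ℚ; 1ℚ; _+_; _*_; _≤_; _<_)
import Data.Rational.Properties as ℚ
open import Data.Sum.Base using (_⊎_)
open import Data.Vec.Base as Vec using (Vec; []; _∷_; count; lookup; zipWith)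
open import Function.Base using (_∘_)
open import Function.Bundles using (_⇔_)
open import Level using (0ℓ)
open import Relation.Binary.Bundles using (DecTotalOrder)
open import Relation.Binary.PropositionalEquality using (_≡_)
open import Relation.Nullary using (¬_)
open import Relation.Unary using (Pred; _∈_)

------------------------------------------------------------------------
-- Real numbers, as two-sided Dedekind cuts.

record ℝ : Set₁ where
  field
    lower upper   : Pred ℚ 0ℓ
    lower-inhab   : ∃ lower
    upper-inhab   : ∃ upper
    lower-rounded : ∀ q → q ∈ lower ⇔ (∃[ r ] q < r × r ∈ lower)
    upper-rounded : ∀ q → q ∈ upper ⇔ (∃[ r ] r < q × r ∈ upper)
    disjoint      : ∀ q → ¬ (q ∈ lower × q ∈ upper)
    located       : ∀ q r → q < r → q ∈ lower ⊎ r ∈ upper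

_ℚ<ℝ_ : ℚ → ℝ → Set
q ℚ<ℝ a = q ∈ ℝ.lower a

_ℝ<ℚ_ : ℝ → ℚ → Set
a ℝ<ℚ q = q ∈ ℝ.upper a

_ℚ≤ℝ_ : ℚ → ℝ → Set
q ℚ≤ℝ a = ¬ (a ℝ<ℚ q)

_ℝ≤ℚ_ : ℝ → ℚ → Set
a ℝ≤ℚ q = ¬ (q ℚ<ℝ a)

_ℝ<ℝ_ : ℝ → ℝ → Set
a ℝ<ℝ b = ∃[ q ] a ℝ<ℚ q × q ℚ<ℝ b

------------------------------------------------------------------------
-- Asymptotics along a set N of admissible lengths.  A set of lengths is
-- needed because σ n * n must be an integer: σ = ½, for instance, only
-- makes sense for even n, and no σ ∈ (0,1) is admissible for n = 1.

ℕ→ℚ : ℕ → ℚ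
ℕ→ℚ m = + m / 1

Unbounded : Pred ℕ 0ℓ → Set
Unbounded N = ∀ m → ∃[ n ] m ℕ.≤ n × n ∈ N

_∈Ω[_]_ : (ℕ → ℚ) → Pred ℕ 0ℓ → (ℕ → ℚ) → Set
f ∈Ω[ N ] g =
  ∃[ c ] 0ℚ < c × ∃[ n₀ ] (∀ n → n ∈ N → n₀ ℕ.≤ n → c * g n ≤ f n)

_∈o[_]_ : (ℕ → ℚ) → Pred ℕ 0ℓ → (ℕ → ℚ) → Set
f ∈o[ N ] g =
  ∀ c → 0ℚ < c → ∃[ n₀ ] (∀ n → n ∈ N → n₀ ℕ.≤ n → f n ≤ c * g n)

------------------------------------------------------------------------
-- Hamming weight and distance

wt : ∀ {n} .{{_ : NonZero n}} → Vec Bool n → ℚ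
wt {n} x = + count (Bool._≟ true) x / n

relDist : ∀ {n} .{{_ : NonZero n}} → Vec Bool n → Vec Bool n → ℚ
relDist {n} x y = + count (Bool._≟ true) (zipWith _xor_ x y) / n

allStrings : ∀ n → List (Vec Bool n)
allStrings zero    = [] ∷ []
allStrings (suc n) =
  List.map (false ∷_) (allStrings n) ++ List.map (true ∷_) (allStrings n)

HW : ∀ n .{{_ : NonZero n}} → ℚ → List (Vec Bool n)
HW n σ = filter (λ x → wt x ℚ.≟ σ) (allStrings n)

-- Relative distances are at most 1, so the default value 1ℚ only matters
-- when HW n σ is empty, that is, when σ * n ∉ {0,…,n}.
Δ-HW : ∀ {n} .{{_ : NonZero n}} → Vec Bool n → ℚ → ℚ
Δ-HW {n} x σ = min 1ℚ (List.map (relDist x) (HW n σ))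
  where open Extrema (DecTotalOrder.totalOrder ℚ.≤-decTotalOrder) using (min)

------------------------------------------------------------------------
-- Finite randomised experiments: each inner node draws j uniformly from
-- Fin (suc k), so every leaf has positive probability.

data Dist (A : Set) : Set where
  pure    : A → Dist A
  uniform : (k : ℕ) → (Fin (suc k) → Dist A) → Dist A

module _ {A : Set} where

  Pr : (A → Bool) → Dist A → ℚ
  Pr E (pure a)      = if E a then 1ℚ else 0ℚ
  Pr E (uniform k d) =
    foldr _+_ 0ℚ (List.tabulate (λ j → Pr E (d j))) * (+ 1 / suc k)

  -- The worst case over the random choices.
  Always : (A → Set) → Dist A → Set
  Always P (pure a)      = P a
  Always P (uniform k d) = ∀ j → Always P (d j)

  bind : {B : Set} → Dist A → (A → Dist B) → Dist B
  bind (pure a)      f = f a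
  bind (uniform k d) f = uniform k (λ j → bind (d j) f)

  mapDist : {B : Set} → (A → B) → Dist A → Dist B
  mapDist f d = bind d (λ a → pure (f a))

------------------------------------------------------------------------
-- Interactive oracle machines

Msg : Set
Msg = List Bool

data Verifier (n : ℕ) : Set where
  decide   : Bool → Verifier n
  query    : Fin n → (Bool → Verifier n) → Verifier n
  sample   : (k : ℕ) → (Fin (suc k) → Verifier n) → Verifier n
  exchange : Msg → (Msg → Verifier n) → Verifier n

data OracleComp (n : ℕ) (A : Set) : Set where
  return : A → OracleComp n A
  query  : Fin n → (Bool → OracleComp n A) → OracleComp n A
  sample : (k : ℕ) → (Fin (suc k) → OracleComp n A) → OracleComp n A

-- The state carries whatever the prover remembers between messages,
-- including its earlier random choices and oracle answers.  There is no
-- bound on its computation, and a cheating prover may depend on the input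
-- string because soundness quantifies over provers after the input.
record Prover (n : ℕ) : Set₁ where
  field
    State   : Set
    start   : State
    respond : State → Msg → OracleComp n (Msg × State)

-- The result, together with the number of oracle queries made.
execute : ∀ {n A} → Vec Bool n → OracleComp n A → Dist (A × ℕ)
execute x (return a)   = pure (a , 0)
execute x (query i c)  =
  mapDist (λ (a , q) → a , suc q) (execute x (c (lookup x i)))
execute x (sample k c) = uniform k (λ j → execute x (c j))

record Outcome : Set where
  constructor outcome
  field
    accepted        : Bool
    verifierQueries : ℕ
    proverQueries   : ℕ

open Outcome public

addQueries : ℕ → ℕ → Outcome → Outcome
addQueries v p (outcome b v′ p′) = outcome b (v ℕ.+ v′) (p ℕ.+ p′)

module _ {n : ℕ} (P : Prover n) (x : Vec Bool n) where
  open Prover P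

  interactFrom : State → Verifier n → Dist Outcome
  interactFrom s (decide b)     = pure (outcome b 0 0)
  interactFrom s (query i V)    =
    mapDist (addQueries 1 0) (interactFrom s (V (lookup x i)))
  interactFrom s (sample k V)   = uniform k (λ j → interactFrom s (V j))
  interactFrom s (exchange m V) =
    bind (execute x (respond s m)) λ ((r , s′) , q) →
      mapDist (addQueries 0 q) (interactFrom s′ (V r))

interact : ∀ {n} → Verifier n → Prover n → Vec Bool n → Dist Outcome
interact V P x = interactFrom P x (Prover.start P) V

VerifierQueryBound : Pred ℕ 0ℓ → (∀ n → Verifier n) → (ℕ → ℕ) → Set₁
VerifierQueryBound N V Q =
  ∀ n → n ∈ N → (x : Vec Bool n) (P : Prover n) →
  Always (λ o → verifierQueries o ℕ.≤ Q n) (interact (V n) P x)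

------------------------------------------------------------------------
-- Interactive proofs of proximity for HW n (σ n), n ∈ N, with perfect
-- completeness and constant soundness error

module _ (N : Pred ℕ 0ℓ) (σ : ℕ → ℚ)
         (V : ∀ n → Verifier n) (Pₕ : ∀ n → Prover n) where

  record IsIPP (εc εf : ℝ) : Set₁ where
    field
      completeness :
        ∀ n .{{_ : NonZero n}} → n ∈ N → (x : Vec Bool n) →
        Δ-HW x (σ n) ℚ≤ℝ εc →
        Pr accepted (interact (V n) (Pₕ n) x) ≡ 1ℚ
      soundness :
        ∃[ δ ] 0ℚ < δ ×
        (∀ n .{{_ : NonZero n}} → n ∈ N → (x : Vec Bool n) →
         εf ℝ<ℚ Δ-HW x (σ n) →
         (P* : Prover n) →
         δ ≤ Pr (not ∘ accepted) (interact (V n) P* x))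

  -- Only runs with the prescribed verifier on completeness instances count.
  HonestProverQueryBound : ℝ → (ℕ → ℕ) → Set
  HonestProverQueryBound εc Q =
    ∀ n .{{_ : NonZero n}} → n ∈ N → (x : Vec Bool n) →
    Δ-HW x (σ n) ℚ≤ℝ εc →
    Always (λ o → proverQueries o ℕ.≤ Q n) (interact (V n) (Pₕ n) x)

{-# OPTIONS --safe #-}
module Submission where

-- The all-zeros string is at distance σ from HW n σ and the all-ones string at
-- distance 1 − σ, so one of them, x, is εf-far and must be rejected with
-- positive probability even when the prover is the honest one.  But consider
-- answering every query, of either party, according to x.  As long as at most
-- QV + QP positions have been queried and enough positions are left, some
-- y ∈ HW n σ agrees with x on all of them.  On y the verifier never rejects and
-- the parties never exceed QV + QP queries, hence the same holds along every
-- run on x: x is always accepted.  No probability is needed beyond "zero" and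
-- "one", and the argument goes by induction on the interaction tree.

open import Defs
open import Data.Bool.Base using (Bool; true; false; not; _xor_)
import Data.Bool.Properties as Bool
open import Data.Fin.Base using (Fin; zero; suc)
import Data.Fin.Properties as Fin
import Data.Integer.Base as ℤ
import Data.Integer.Properties as ℤ
open import Data.List.Base as List using (List; []; _∷_; foldr)
import Data.List.Extrema as Extrema
import Data.List.Membership.Propositional as Mem
open import Data.List.Membership.Propositional.Properties
  using (∈-map⁺; ∈-map⁻; ∈-++⁺ˡ; ∈-++⁺ʳ; ∈-filter⁺; ∈-filter⁻)
import Data.List.Relation.Unary.All as All
import Data.List.Relation.Unary.Any as Any
open import Data.Nat.Base as ℕ using (ℕ; zero; suc; NonZero; z≤n; s≤s)
import Data.Nat.Properties as ℕ
open import Data.Product.Base using (_×_; ∃-syntax; _,_; proj₁; proj₂)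
open import Data.Rational.Base
  using (ℚ; 0ℚ; 1ℚ; _≤_; _<_; _+_; _-_; -_; _*_; _⊓_; _⊔_; _/_; toℚᵘ; positive)
import Data.Rational.Properties as ℚ
open import Data.Rational.Solver using (module +-*-Solver)
open import Data.Rational.Unnormalised.Base as ℚᵘ using (mkℚᵘ; *≡*)
import Data.Rational.Unnormalised.Properties as ℚᵘ
open import Data.Sum.Base using (inj₁; inj₂)
open import Data.Vec.Base using (Vec; []; _∷_; count; lookup; map; replicate; zipWith; _[_]≔_)
open import Data.Vec.Properties
  using (lookup∘update; lookup∘update′)
open import Function.Base using (_∘_)
open import Function.Bundles using (Equivalence)
open import Level using (0ℓ)
open import Relation.Binary.Bundles using (DecTotalOrder)
open import Relation.Binary.PropositionalEquality
  using (_≡_; refl; sym; trans; cong; cong₂; subst; module ≡-Reasoning)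
open import Relation.Nullary using (¬_; yes; no; contradiction)
open import Relation.Unary using (Pred; _∈_)

open Extrema (DecTotalOrder.totalOrder ℚ.≤-decTotalOrder) using (min≤v⁺; v≤min⁺)

private variable
  A B : Set
  n : ℕ

-- Properties of all runs of an experiment

module _ {P : B → Set} {f : A → Dist B} where

  Always-bind⁺ : ∀ d → Always (Always P ∘ f) d → Always P (bind d f)
  Always-bind⁺ (pure a)      p = p
  Always-bind⁺ (uniform k d) p = λ j → Always-bind⁺ (d j) (p j)

  Always-bind⁻ : ∀ d → Always P (bind d f) → Always (Always P ∘ f) d
  Always-bind⁻ (pure a)      p = p
  Always-bind⁻ (uniform k d) p = λ j → Always-bind⁻ (d j) (p j)

Always-map : {P Q : A → Set} → (∀ a → P a → Q a) → ∀ d → Always P d → Always Q d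
Always-map f (pure a)      p = f a p
Always-map f (uniform k d) p = λ j → Always-map f (d j) (p j)

Always-zip : {P Q : A → Set} → ∀ d → Always P d → Always Q d →
             Always (λ a → P a × Q a) d
Always-zip (pure a)      p q = p , q
Always-zip (uniform k d) p q = λ j → Always-zip (d j) (p j) (q j)

-- Every draw is from a nonempty set, so following first outcomes reaches a leaf. This supplies the
-- run whose query count contradicts an exhausted budget.
Always⇒∃ : {P : A → Set} → ∀ d → Always P d → ∃[ a ] P a
Always⇒∃ (pure a)      p = a , p
Always⇒∃ (uniform k d) p = Always⇒∃ (d zero) (p zero)

-- Hamming distance and the inputs still possible

weight : Vec Bool n → ℕ
weight = count (Bool._≟ true)

dist : Vec Bool n → Vec Bool n → ℕ
dist x y = weight (zipWith _xor_ x y)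

dist-refl : (x : Vec Bool n) → dist x x ≡ 0
dist-refl []          = refl
dist-refl (false ∷ x) = dist-refl x
dist-refl (true  ∷ x) = dist-refl x

dist-map-not : (x : Vec Bool n) → dist x (map not x) ≡ n
dist-map-not []          = refl
dist-map-not (false ∷ x) = cong suc (dist-map-not x)
dist-map-not (true  ∷ x) = cong suc (dist-map-not x)

-- The price of a query: fixing one position to its value in `x` removes at most one difference.
dist-update : (x z : Vec Bool n) (i : Fin n) →
              dist x z ℕ.≤ suc (dist x (z [ i ]≔ lookup x i))
dist-update (false ∷ x) (false ∷ z) zero    = ℕ.n≤1+n _
dist-update (false ∷ x) (true  ∷ z) zero    = ℕ.≤-refl
dist-update (true  ∷ x) (false ∷ z) zero    = ℕ.≤-refl
dist-update (true  ∷ x) (true  ∷ z) zero    = ℕ.n≤1+n _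
dist-update (false ∷ x) (false ∷ z) (suc i) = dist-update x z i
dist-update (false ∷ x) (true  ∷ z) (suc i) = s≤s (dist-update x z i)
dist-update (true  ∷ x) (false ∷ z) (suc i) = s≤s (dist-update x z i)
dist-update (true  ∷ x) (true  ∷ z) (suc i) = dist-update x z i

-- With a string read as the set of positions where it differs from `x`, this is inclusion of sets,
-- in contrapositive form.
_⊢_≼_ : Vec Bool n → Vec Bool n → Vec Bool n → Set
x ⊢ y ≼ z = ∀ i → lookup z i ≡ lookup x i → lookup y i ≡ lookup x i

update-≼ : (x z : Vec Bool n) (i : Fin n) → x ⊢ z [ i ]≔ lookup x i ≼ z
update-≼ x z i j z≡x with j Fin.≟ i
... | yes refl = lookup∘update i z (lookup x i)
... | no  j≢i  = trans (lookup∘update′ j≢i z (lookup x i)) z≡x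

∷-≼ : ∀ {a c} (x z : Vec Bool n) {y} → x ⊢ y ≼ z → (a ∷ x) ⊢ c ∷ y ≼ (c ∷ z)
∷-≼ x z y≼z zero    = λ c≡a → c≡a
∷-≼ x z y≼z (suc i) = y≼z i

-- A finite set has subsets of every smaller size: `y` copies `z` until `w` differences from `x`
-- have been collected, and copies `x` from then on.
≼-dist : (x z : Vec Bool n) {w : ℕ} → w ℕ.≤ dist x z →
         ∃[ y ] x ⊢ y ≼ z × dist x y ≡ w
≼-dist x z {zero} _ = x , (λ _ _ → refl) , dist-refl x
≼-dist [] [] {suc _} ()
≼-dist (false ∷ x) (false ∷ z) {suc w} h =
  let y , y≼z , eq = ≼-dist x z h
  in false ∷ y , ∷-≼ x z y≼z , eq
≼-dist (true ∷ x) (true ∷ z) {suc w} h =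
  let y , y≼z , eq = ≼-dist x z h
  in true ∷ y , ∷-≼ x z y≼z , eq
≼-dist (false ∷ x) (true ∷ z) {suc w} (s≤s h) =
  let y , y≼z , eq = ≼-dist x z h
  in true ∷ y , ∷-≼ x z y≼z , cong suc eq
≼-dist (true ∷ x) (false ∷ z) {suc w} (s≤s h) =
  let y , y≼z , eq = ≼-dist x z h
  in false ∷ y , ∷-≼ x z y≼z , cong suc eq

-- Transfer of acceptance along the interaction tree

Efficient : ℕ → Outcome → Set
Efficient m o = accepted o ≡ true × verifierQueries o ℕ.+ proverQueries o ℕ.≤ m

Accepts : Outcome → Set
Accepts o = accepted o ≡ true

-- z differs from x exactly at the positions that have not been queried yet,
-- and the inputs y still possible are those with x ⊢ y ≼ z.  The argument m of
-- G is the number of queries left.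
module Adversary (x : Vec Bool n) (w : ℕ) where

  -- `G m y` is what is known of the runs on a candidate `y`, and `g` is what is to be shown for
  -- `x`. The inequality keeps at least `w` positions unqueried after `m` more queries, so by
  -- `≼-dist` a candidate at distance `w` remains.
  Forces : (ℕ → Vec Bool n → Set) → Set → Set
  Forces G g = ∀ z m → m ℕ.+ w ℕ.≤ dist x z →
    (∀ y → x ⊢ y ≼ z → dist x y ≡ w → G m y) → g

  forces-base : ∀ {G g} → (∀ m y → G m y → g) → Forces G g
  forces-base G⇒g z m room good =
    let y , y≼z , eq = ≼-dist x z (ℕ.m+n≤o⇒n≤o m room)
    in G⇒g m y (good y y≼z eq)

  -- With no queries left, the budget of any candidate excludes another one. Otherwise position `i`
  -- is fixed to its value in `x`; every remaining candidate was one before and answers the query as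
  -- `x` does, so its runs take the same branch.
  forces-query : ∀ {G G′ g} i → (∀ y → ¬ G′ 0 y) →
    (∀ m y → lookup y i ≡ lookup x i → G′ (suc m) y → G m y) →
    Forces G g → Forces G′ g
  forces-query i ¬G′0 step forces z zero room good =
    let y , y≼z , eq = ≼-dist x z room
    in contradiction (good y y≼z eq) (¬G′0 y)
  forces-query i ¬G′0 step forces z (suc m) room good =
    forces (z [ i ]≔ lookup x i) m
      (ℕ.s≤s⁻¹ (ℕ.≤-trans room (dist-update x z i)))
      (λ y y≼z′ eq → step m y
        (y≼z′ i (lookup∘update i z (lookup x i)))
        (good y (λ j → y≼z′ j ∘ update-≼ x z i j) eq))

  module _ (K : A → Vec Bool n → Dist Outcome)
           (K-forces : ∀ a → Forces (λ m y → Always (Efficient m) (K a y))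
                                    (Always Accepts (K a x))) where

    -- The budget `m` is shared by the `q` queries of the prover's computation and the continuation
    -- `K`, so the two are followed together.
    ExecGood : ℕ → Vec Bool n → OracleComp n A → Set
    ExecGood m y c =
      Always (λ (a , q) → Always (Efficient m ∘ addQueries 0 q) (K a y)) (execute y c)

    forces-execute : ∀ c → Forces (λ m y → ExecGood m y c)
                       (Always (λ (a , _) → Always Accepts (K a x)) (execute x c))
    forces-execute (return a) = K-forces a
    forces-execute (query i c) =
      forces-query i
        (λ y good →
          let run = execute y (c (lookup y i))
              -- One run on `y` suffices: it counts the present query, so its total is a successor
              -- and cannot be at most 0.
              (a , q) , good′ = Always⇒∃ run (Always-bind⁻ run good)
              o , _ , le = Always⇒∃ {P = Efficient 0 ∘ addQueries 0 (suc q)} (K a y) good′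
          in ℕ.n≮0 (subst (ℕ._≤ 0) (ℕ.+-suc (verifierQueries o) _) le))
        (λ m y eq good →
          subst (λ b → ExecGood m y (c b)) eq
            (Always-map
              (λ (a , q) → Always-map
                (λ o (acc , le) →
                  acc , ℕ.s≤s⁻¹ (subst (ℕ._≤ suc m) (ℕ.+-suc (verifierQueries o) _) le))
                (K a y))
              (execute y (c (lookup y i)))
              (Always-bind⁻ (execute y (c (lookup y i))) good)))
        (λ z m room good → Always-bind⁺ (execute x (c (lookup x i)))
          (forces-execute (c (lookup x i)) z m room good))
    -- Draws do not depend on the input: `x` and `y` share the branch `j`, and no position is used
    -- up.
    forces-execute (sample k c) z m room good j =
      forces-execute (c j) z m room (λ y y≼z eq → good y y≼z eq j)

  module _ (P : Prover n) where
    open Prover P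

    forces-interact : ∀ W s → Forces (λ m y → Always (Efficient m) (interactFrom P y s W))
                                (Always Accepts (interactFrom P x s W))
    forces-interact (decide b) s = forces-base (λ _ _ → proj₁)
    forces-interact (query i W) s =
      forces-query i
        (λ y good →
          let run = interactFrom P y s (W (lookup y i))
              _ , _ , le = Always⇒∃ {P = Efficient 0 ∘ addQueries 1 0} run (Always-bind⁻ run good)
          in ℕ.n≮0 le)
        (λ m y eq good →
          subst (λ b → Always (Efficient m) (interactFrom P y s (W b))) eq
            (Always-map (λ _ (acc , le) → acc , ℕ.s≤s⁻¹ le) (interactFrom P y s (W (lookup y i)))
              (Always-bind⁻ (interactFrom P y s (W (lookup y i))) good)))
        (λ z m room good → Always-bind⁺ (interactFrom P x s (W (lookup x i)))
          (forces-interact (W (lookup x i)) s z m room good))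
    forces-interact (sample k W) s z m room good j =
      forces-interact (W j) s z m room (λ y y≼z eq → good y y≼z eq j)
    forces-interact (exchange msg W) s z m room good =
      Always-bind⁺ (execute x (respond s msg))
        (Always-map (λ ((r , s′) , _) → Always-bind⁺ (interactFrom P x s′ (W r)))
          (execute x (respond s msg))
          -- The continuation is the interaction resumed with reply `r` and prover state `s′`; what
          -- it must satisfy is the induction hypothesis for `W r`.
          (forces-execute (λ (r , s′) y → interactFrom P y s′ (W r))
            (λ (r , s′) → forces-interact (W r) s′)
            (respond s msg) z m room
            (λ y y≼z eq →
              Always-map (λ ((r , s′) , _) → Always-bind⁻ (interactFrom P y s′ (W r)))
                (execute y (respond s msg))
                (Always-bind⁻ (execute y (respond s msg)) (good y y≼z eq)))))

accepts-at-distance : (V : Verifier n) (P : Prover n) (x : Vec Bool n) {w q : ℕ} →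
  q ℕ.+ w ℕ.≤ n →
  (∀ y → dist x y ≡ w → Always (Efficient q) (interact V P y)) →
  Always Accepts (interact V P x)
accepts-at-distance {n} V P x {w} {q} room good =
  -- The complement of `x` differs from it everywhere: no position has been queried yet.
  Adversary.forces-interact x w P V (Prover.start P) (map not x) q
    (subst (q ℕ.+ w ℕ.≤_) (sym (dist-map-not x)) room)
    (λ y _ → good y)

-- Rational arithmetic

≤⇒≯ : ∀ {p q} → p ≤ q → ¬ q < p
≤⇒≯ p≤q q<p = ℚ.<-irrefl refl (ℚ.<-≤-trans q<p p≤q)

Σ : ∀ {m} → (Fin m → ℚ) → ℚ
Σ f = foldr _+_ 0ℚ (List.tabulate f)

-- Since `_/_` reduces fractions to lowest terms, the equation is checked on unnormalised
-- representatives.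
ℕ→ℚ-homo-+ : ∀ a b → ℕ→ℚ (a ℕ.+ b) ≡ ℕ→ℚ a + ℕ→ℚ b
ℕ→ℚ-homo-+ a b = ℚ.toℚᵘ-injective (begin-equality
  toℚᵘ (ℕ→ℚ (a ℕ.+ b))             ≃⟨ ℚ.toℚᵘ-fromℚᵘ (mkℚᵘ (ℤ.+ (a ℕ.+ b)) 0) ⟩
  mkℚᵘ (ℤ.+ (a ℕ.+ b)) 0            ≡⟨ cong (λ i → mkℚᵘ i 0)
    (cong₂ ℤ._+_ (ℤ.*-identityʳ (ℤ.+ a)) (ℤ.*-identityʳ (ℤ.+ b))) ⟨
  mkℚᵘ (ℤ.+ a) 0 ℚᵘ.+ mkℚᵘ (ℤ.+ b) 0 ≃⟨ ℚᵘ.+-cong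
    (ℚ.toℚᵘ-fromℚᵘ (mkℚᵘ (ℤ.+ a) 0)) (ℚ.toℚᵘ-fromℚᵘ (mkℚᵘ (ℤ.+ b) 0)) ⟨
  toℚᵘ (ℕ→ℚ a) ℚᵘ.+ toℚᵘ (ℕ→ℚ b)  ≃⟨ ℚ.toℚᵘ-homo-+ (ℕ→ℚ a) (ℕ→ℚ b) ⟨
  toℚᵘ (ℕ→ℚ a + ℕ→ℚ b)             ∎)
  where open ℚᵘ.≤-Reasoning

/-*-cancel : ∀ a n .{{_ : NonZero n}} → (ℤ.+ a / n) * ℕ→ℚ n ≡ ℕ→ℚ a
/-*-cancel a n@(suc d) = ℚ.toℚᵘ-injective (begin-equality
  toℚᵘ ((ℤ.+ a / n) * ℕ→ℚ n)           ≃⟨ ℚ.toℚᵘ-homo-* (ℤ.+ a / n) (ℕ→ℚ n) ⟩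
  toℚᵘ (ℤ.+ a / n) ℚᵘ.* toℚᵘ (ℕ→ℚ n)   ≃⟨ ℚᵘ.*-cong
    (ℚ.toℚᵘ-fromℚᵘ (mkℚᵘ (ℤ.+ a) d)) (ℚ.toℚᵘ-fromℚᵘ (mkℚᵘ (ℤ.+ n) 0)) ⟩
  mkℚᵘ (ℤ.+ a) d ℚᵘ.* mkℚᵘ (ℤ.+ n) 0    ≃⟨ *≡* (trans (ℤ.*-identityʳ _)
    (cong (λ m → ℤ.+ a ℤ.* (ℤ.+ m)) (sym (ℕ.*-identityʳ n)))) ⟩
  mkℚᵘ (ℤ.+ a) 0                         ≃⟨ ℚ.toℚᵘ-fromℚᵘ (mkℚᵘ (ℤ.+ a) 0) ⟨
  toℚᵘ (ℕ→ℚ a)                          ∎)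
  where open ℚᵘ.≤-Reasoning

ℕ→ℚ-mono-≤ : ∀ {a b} → a ℕ.≤ b → ℕ→ℚ a ≤ ℕ→ℚ b
ℕ→ℚ-mono-≤ {a} {b} a≤b = ℚ.toℚᵘ-cancel-≤ (begin
  toℚᵘ (ℕ→ℚ a)   ≃⟨ ℚ.toℚᵘ-fromℚᵘ (mkℚᵘ (ℤ.+ a) 0) ⟩
  mkℚᵘ (ℤ.+ a) 0  ≤⟨ ℚᵘ.*≤* (ℤ.*-monoʳ-≤-nonNeg (ℤ.+ 1) (ℤ.+≤+ a≤b)) ⟩
  mkℚᵘ (ℤ.+ b) 0  ≃⟨ ℚ.toℚᵘ-fromℚᵘ (mkℚᵘ (ℤ.+ b) 0) ⟨
  toℚᵘ (ℕ→ℚ b)   ∎)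
  where open ℚᵘ.≤-Reasoning

ℕ→ℚ-injective : ∀ {a b} → ℕ→ℚ a ≡ ℕ→ℚ b → a ≡ b
ℕ→ℚ-injective {a} {b} eq with ℚ.fromℚᵘ-injective {mkℚᵘ (ℤ.+ a) 0} {mkℚᵘ (ℤ.+ b) 0} eq
... | *≡* eq′ = ℤ.+-injective (ℤ.*-cancelʳ-≡ (ℤ.+ a) (ℤ.+ b) (ℤ.+ 1) eq′)

ℕ→ℚ-pos : ∀ n .{{_ : NonZero n}} → 0ℚ < ℕ→ℚ n
ℕ→ℚ-pos (suc n) = ℚ.<-≤-trans (ℚ.positive⁻¹ 1ℚ) (ℕ→ℚ-mono-≤ {1} {suc n} (s≤s z≤n))

module _ (n : ℕ) .{{_ : NonZero n}} where

  *-ℕ→ℚ-cancel : ∀ {p q} → p * ℕ→ℚ n ≡ q * ℕ→ℚ n → p ≡ q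
  *-ℕ→ℚ-cancel eq =
    ℚ.≤-antisym (ℚ.*-cancelʳ-≤-pos (ℕ→ℚ n) (ℚ.≤-reflexive eq))
                (ℚ.*-cancelʳ-≤-pos (ℕ→ℚ n) (ℚ.≤-reflexive (sym eq)))
    where instance _ = positive (ℕ→ℚ-pos n)

  /-unique : ∀ {p} a → p * ℕ→ℚ n ≡ ℕ→ℚ a → p ≡ ℤ.+ a / n
  /-unique a eq = *-ℕ→ℚ-cancel (trans eq (sym (/-*-cancel a n)))

  /-injective : ∀ a b → ℤ.+ a / n ≡ ℤ.+ b / n → a ≡ b
  /-injective a b eq = ℕ→ℚ-injective
    (trans (sym (/-*-cancel a n)) (trans (cong (_* ℕ→ℚ n) eq) (/-*-cancel b n)))

  1-/ : ∀ {a} → a ℕ.≤ n → 1ℚ - (ℤ.+ a / n) ≡ ℤ.+ (n ℕ.∸ a) / n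
  1-/ {a} a≤n = /-unique (n ℕ.∸ a) (begin
    (1ℚ - (ℤ.+ a / n)) * ℕ→ℚ n             ≡⟨ ℚ.*-distribʳ-+ (ℕ→ℚ n) 1ℚ (- (ℤ.+ a / n)) ⟩
    1ℚ * ℕ→ℚ n + - (ℤ.+ a / n) * ℕ→ℚ n     ≡⟨ cong₂ _+_
      (ℚ.*-identityˡ (ℕ→ℚ n)) (sym (ℚ.neg-distribˡ-* (ℤ.+ a / n) (ℕ→ℚ n))) ⟩
    ℕ→ℚ n - (ℤ.+ a / n) * ℕ→ℚ n            ≡⟨ cong (λ r → ℕ→ℚ n - r) (/-*-cancel a n) ⟩
    ℕ→ℚ n - ℕ→ℚ a                           ≡⟨ cong (λ m → ℕ→ℚ m - ℕ→ℚ a) (ℕ.m∸n+n≡m a≤n) ⟨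
    ℕ→ℚ (n ℕ.∸ a ℕ.+ a) - ℕ→ℚ a            ≡⟨ cong (_- ℕ→ℚ a) (ℕ→ℚ-homo-+ (n ℕ.∸ a) a) ⟩
    ℕ→ℚ (n ℕ.∸ a) + ℕ→ℚ a - ℕ→ℚ a         ≡⟨ ℚ.+-assoc (ℕ→ℚ (n ℕ.∸ a)) (ℕ→ℚ a) (- ℕ→ℚ a) ⟩
    ℕ→ℚ (n ℕ.∸ a) + (ℕ→ℚ a - ℕ→ℚ a)       ≡⟨ cong (ℕ→ℚ (n ℕ.∸ a) +_) (ℚ.+-inverseʳ (ℕ→ℚ a)) ⟩
    ℕ→ℚ (n ℕ.∸ a) + 0ℚ                      ≡⟨ ℚ.+-identityʳ (ℕ→ℚ (n ℕ.∸ a)) ⟩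
    ℕ→ℚ (n ℕ.∸ a)                           ∎)
    where open ≡-Reasoning

-- Averages and the probabilities zero and one

Σ-≤ : ∀ {m} (f : Fin m → ℚ) → (∀ j → f j ≤ 1ℚ) → Σ f ≤ ℕ→ℚ m
Σ-≤ {zero}  f f≤1 = ℚ.≤-refl
Σ-≤ {suc m} f f≤1 = ℚ.≤-trans
  (ℚ.+-mono-≤ (f≤1 zero) (Σ-≤ (f ∘ suc) (f≤1 ∘ suc)))
  (ℚ.≤-reflexive (sym (ℕ→ℚ-homo-+ 1 m)))

+-tight : ∀ {a b c d} → a ≤ c → b ≤ d → c + d ≤ a + b → c ≤ a × d ≤ b
+-tight a≤c b≤d c+d≤a+b =
  ℚ.≮⇒≥ (λ a<c → ≤⇒≯ c+d≤a+b (ℚ.+-mono-<-≤ a<c b≤d)) ,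
  ℚ.≮⇒≥ (λ b<d → ≤⇒≯ c+d≤a+b (ℚ.+-mono-≤-< a≤c b<d))

Σ-tight : ∀ {m} (f : Fin m → ℚ) → (∀ j → f j ≤ 1ℚ) → ℕ→ℚ m ≤ Σ f → ∀ j → 1ℚ ≤ f j
Σ-tight {suc m} f f≤1 m≤Σ = λ where
    zero    → proj₁ tight
    (suc j) → Σ-tight (f ∘ suc) (f≤1 ∘ suc) (proj₂ tight) j
  where
  tight = +-tight (f≤1 zero) (Σ-≤ (f ∘ suc) (f≤1 ∘ suc))
            (ℚ.≤-trans (ℚ.≤-reflexive (sym (ℕ→ℚ-homo-+ 1 m))) m≤Σ)

Σ-zero : ∀ {m} (f : Fin m → ℚ) → (∀ j → f j ≡ 0ℚ) → Σ f ≡ 0ℚ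
Σ-zero {zero}  f f≡0 = refl
Σ-zero {suc m} f f≡0 = cong₂ _+_ (f≡0 zero) (Σ-zero (f ∘ suc) (f≡0 ∘ suc))

1/-inverse : ∀ n .{{_ : NonZero n}} → ℕ→ℚ n * (ℤ.+ 1 / n) ≡ 1ℚ
1/-inverse n = trans (ℚ.*-comm (ℕ→ℚ n) (ℤ.+ 1 / n)) (/-*-cancel 1 n)

module _ (E : A → Bool) where

  Pr≤1 : ∀ d → Pr E d ≤ 1ℚ
  Pr≤1 (pure a) with E a
  ... | true  = ℚ.≤-refl
  ... | false = ℚ.nonNegative⁻¹ 1ℚ
  Pr≤1 (uniform k d) = begin
    Σ (Pr E ∘ d) * (ℤ.+ 1 / suc k)  ≤⟨ ℚ.*-monoʳ-≤-nonNeg (ℤ.+ 1 / suc k)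
      {{ℚ.normalize-nonNeg 1 (suc k)}} (Σ-≤ (Pr E ∘ d) (Pr≤1 ∘ d)) ⟩
    ℕ→ℚ (suc k) * (ℤ.+ 1 / suc k)   ≡⟨ 1/-inverse (suc k) ⟩
    1ℚ                               ∎
    where open ℚ.≤-Reasoning

  -- An average of numbers that are at most 1 reaches 1 only if each of them does. This turns
  -- perfect completeness into a statement about every single run.
  Pr≥1⇒Always : ∀ d → 1ℚ ≤ Pr E d → Always (λ a → E a ≡ true) d
  Pr≥1⇒Always (pure a) 1≤Pr with E a
  ... | true  = refl
  ... | false = contradiction (ℚ.positive⁻¹ 1ℚ) (≤⇒≯ 1≤Pr)
  Pr≥1⇒Always (uniform k d) 1≤Pr j =
    Pr≥1⇒Always (d j) (Σ-tight (Pr E ∘ d) (Pr≤1 ∘ d)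
      (ℚ.*-cancelʳ-≤-pos (ℤ.+ 1 / suc k) {{ℚ.normalize-pos 1 (suc k)}}
        (ℚ.≤-trans (ℚ.≤-reflexive (1/-inverse (suc k))) 1≤Pr)) j)

  Always⇒Pr-not≡0 : ∀ d → Always (λ a → E a ≡ true) d → Pr (not ∘ E) d ≡ 0ℚ
  Always⇒Pr-not≡0 (pure a)      e rewrite e = refl
  Always⇒Pr-not≡0 (uniform k d) e = trans
    (cong (_* (ℤ.+ 1 / suc k)) (Σ-zero (Pr (not ∘ E) ∘ d) (λ j → Always⇒Pr-not≡0 (d j) (e j))))
    (ℚ.*-zeroˡ (ℤ.+ 1 / suc k))

-- Distance to a weight level

∈-allStrings : (x : Vec Bool n) → x Mem.∈ allStrings n
∈-allStrings []          = Any.here refl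
∈-allStrings (false ∷ x) = ∈-++⁺ˡ (∈-map⁺ (false ∷_) (∈-allStrings x))
∈-allStrings (true  ∷ x) = ∈-++⁺ʳ (List.map (false ∷_) (allStrings _))
                             (∈-map⁺ (true ∷_) (∈-allStrings x))

module _ {n} .{{_ : NonZero n}} {σ : ℚ} where

  ∈HW⇒Δ≤0 : (x : Vec Bool n) → wt x ≡ σ → Δ-HW x σ ≤ 0ℚ
  ∈HW⇒Δ≤0 x wt≡σ = min≤v⁺ 1ℚ (List.map (relDist x) (HW n σ)) (inj₂ (Any.map
    (λ eq → ℚ.≤-trans (ℚ.≤-reflexive (sym eq)) (ℚ.≤-reflexive relDist≡0))
    (∈-map⁺ (relDist x) (∈-filter⁺ (λ y → wt y ℚ.≟ σ) (∈-allStrings x) wt≡σ))))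
    where
    relDist≡0 : relDist x x ≡ 0ℚ
    relDist≡0 = trans (cong (λ d → ℤ.+ d / n) (dist-refl x))
                      (sym (/-unique n 0 (ℚ.*-zeroˡ (ℕ→ℚ n))))

  -- The minimum in `Δ-HW` includes the default value 1, which the hypothesis `r ≤ 1ℚ` covers.
  Δ-HW-≥ : (x : Vec Bool n) {r : ℚ} → r ≤ 1ℚ → (∀ y → wt y ≡ σ → r ≤ relDist x y) →
           r ≤ Δ-HW x σ
  Δ-HW-≥ x {r} r≤1 r≤ = v≤min⁺ r≤1 (All.tabulate λ d∈ →
    let y , y∈HW , d≡ = ∈-map⁻ (relDist x) d∈
    in subst (r ≤_) (sym d≡) (r≤ y (proj₂ (∈-filter⁻ (λ y → wt y ℚ.≟ σ) {xs = allStrings n} y∈HW))))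

ℝ<ℚ-≤-trans : ∀ (a : ℝ) {p q} → a ℝ<ℚ p → p ≤ q → a ℝ<ℚ q
ℝ<ℚ-≤-trans a {p} {q} a<p p≤q =
  let r , r<p , a<r = Equivalence.to (ℝ.upper-rounded a p) a<p
  in Equivalence.from (ℝ.upper-rounded a q) (r , ℚ.<-≤-trans r<p p≤q , a<r)

-- Weight levels as spheres around the constant strings

dist-zeros : (y : Vec Bool n) → dist (replicate n false) y ≡ weight y
dist-zeros []          = refl
dist-zeros (false ∷ y) = dist-zeros y
dist-zeros (true  ∷ y) = cong suc (dist-zeros y)

-- The sum form gives both directions at once: distance from the all-ones string and weight
-- determine each other.
dist-ones+weight : (y : Vec Bool n) → dist (replicate n true) y ℕ.+ weight y ≡ n
dist-ones+weight []          = refl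
dist-ones+weight (false ∷ y) = cong suc (dist-ones+weight y)
dist-ones+weight (true  ∷ y) = trans (ℕ.+-suc _ _) (cong suc (dist-ones+weight y))

module _ {n} (y : Vec Bool n) where

  dist-ones : dist (replicate n true) y ≡ n ℕ.∸ weight y
  dist-ones = trans (sym (ℕ.m+n∸n≡m (dist (replicate n true) y) (weight y)))
                    (cong (ℕ._∸ weight y) (dist-ones+weight y))

  weight-ones : weight y ≡ n ℕ.∸ dist (replicate n true) y
  weight-ones = trans (sym (ℕ.m+n∸m≡n (dist (replicate n true) y) (weight y)))
                      (cong (ℕ._∸ dist (replicate n true) y) (dist-ones+weight y))

-- Linear growth

1-p+p≡1 : ∀ p → 1ℚ - p + p ≡ 1ℚ
1-p+p≡1 p = trans (ℚ.+-assoc 1ℚ (- p) p) (cong (1ℚ +_) (ℚ.+-inverseˡ p))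

-- The gap `n - w` is at least `c * n` by the first inequality and at most `q` by the second.
linear-bound : ∀ n .{{_ : NonZero n}} c w q → c + (ℤ.+ w / n) ≤ 1ℚ → n ℕ.≤ q ℕ.+ w →
               c * ℕ→ℚ n ≤ ℕ→ℚ q
linear-bound n c w q c+w/n≤1 n≤q+w = +-cancelʳ-≤ (ℕ→ℚ w) (begin
  c * ℕ→ℚ n + ℕ→ℚ w                       ≡⟨ cong (c * ℕ→ℚ n +_) (/-*-cancel w n) ⟨
  c * ℕ→ℚ n + (ℤ.+ w / n) * ℕ→ℚ n        ≡⟨ ℚ.*-distribʳ-+ (ℕ→ℚ n) c (ℤ.+ w / n) ⟨
  (c + (ℤ.+ w / n)) * ℕ→ℚ n               ≤⟨ ℚ.*-monoʳ-≤-nonNeg (ℕ→ℚ n) {{ℚ.normalize-nonNeg n 1}} c+w/n≤1 ⟩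
  1ℚ * ℕ→ℚ n                               ≡⟨ ℚ.*-identityˡ (ℕ→ℚ n) ⟩
  ℕ→ℚ n                                    ≤⟨ ℕ→ℚ-mono-≤ n≤q+w ⟩
  ℕ→ℚ (q ℕ.+ w)                            ≡⟨ ℕ→ℚ-homo-+ q w ⟩
  ℕ→ℚ q + ℕ→ℚ w                           ∎)
  where
  open ℚ.≤-Reasoning
  +-cancelʳ-≤ : ∀ r {p q} → p + r ≤ q + r → p ≤ q
  +-cancelʳ-≤ r {p} {q} le = ℚ.≮⇒≥ (λ q<p → ≤⇒≯ le (ℚ.+-monoˡ-< r q<p))

not-both-sublinear : ∀ {N} (f g : ℕ → ℕ) → Unbounded N →
  (λ n → ℕ→ℚ (f n ℕ.+ g n)) ∈Ω[ N ] ℕ→ℚ →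
  (λ n → ℕ→ℚ (f n)) ∈o[ N ] ℕ→ℚ → ¬ ((λ n → ℕ→ℚ (g n)) ∈o[ N ] ℕ→ℚ)
not-both-sublinear f g unbounded (c , 0<c , n₀ , Ω) f∈o g∈o =
  -- A third of `c` for each of `f` and `g`: their bounds are not strict, and the third left over
  -- gives the strict gap.
  let e = c * ⅓
      0<e = ℚ.positive⁻¹ e {{ℚ.pos*pos⇒pos c {{positive 0<c}} ⅓}}
      n₁ , f≤ = f∈o e 0<e
      n₂ , g≤ = g∈o e 0<e
      -- The `suc` makes `n`, and with it the leftover third, positive.
      n , large , n∈N = unbounded (suc (n₀ ℕ.⊔ (n₁ ℕ.⊔ n₂)))
      n₀⊔n₁⊔n₂≤n = ℕ.<⇒≤ large
      n₁⊔n₂≤n = ℕ.m⊔n≤o⇒n≤o n₀ _ n₀⊔n₁⊔n₂≤n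
      instance _ = ℕ.>-nonZero (ℕ.≤-trans (s≤s z≤n) large)
               _ = positive 0<e
      0<en = ℚ.positive⁻¹ (e * ℕ→ℚ n) {{ℚ.pos*pos⇒pos e (ℕ→ℚ n) {{positive (ℕ→ℚ-pos n)}}}}
  in ℚ.<-irrefl refl (begin-strict
    e * ℕ→ℚ n + e * ℕ→ℚ n                  ≡⟨ ℚ.+-identityˡ _ ⟨
    0ℚ + (e * ℕ→ℚ n + e * ℕ→ℚ n)           <⟨ ℚ.+-monoˡ-< (e * ℕ→ℚ n + e * ℕ→ℚ n) 0<en ⟩
    e * ℕ→ℚ n + (e * ℕ→ℚ n + e * ℕ→ℚ n)    ≡⟨ thirds c (ℕ→ℚ n) ⟩
    c * ℕ→ℚ n                               ≤⟨ Ω n n∈N (ℕ.m⊔n≤o⇒m≤o n₀ _ n₀⊔n₁⊔n₂≤n) ⟩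
    ℕ→ℚ (f n ℕ.+ g n)                       ≡⟨ ℕ→ℚ-homo-+ (f n) (g n) ⟩
    ℕ→ℚ (f n) + ℕ→ℚ (g n)                   ≤⟨ ℚ.+-mono-≤
      (f≤ n n∈N (ℕ.m⊔n≤o⇒m≤o n₁ n₂ n₁⊔n₂≤n))
      (g≤ n n∈N (ℕ.m⊔n≤o⇒n≤o n₁ n₂ n₁⊔n₂≤n)) ⟩
    e * ℕ→ℚ n + e * ℕ→ℚ n                  ∎)
  where
  open ℚ.≤-Reasoning
  ⅓ : ℚ
  ⅓ = ℤ.+ 1 / 3
  thirds : ∀ p q → p * ⅓ * q + (p * ⅓ * q + p * ⅓ * q) ≡ p * q
  thirds = solve 2 (λ p q → p :* con ⅓ :* q :+ (p :* con ⅓ :* q :+ p :* con ⅓ :* q) := p :* q) refl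
    where open +-*-Solver

-- The query bound at a fixed length

module _ {N σ V Pₕ εc εf} (0≤εc : 0ℚ ℚ≤ℝ εc) (ipp : IsIPP N σ V Pₕ εc εf)
         {QV QP} (V-bound : VerifierQueryBound N V QV)
         (P-bound : HonestProverQueryBound N σ V Pₕ εc QP)
         {n : ℕ} .{{_ : NonZero n}} (n∈N : n ∈ N) where
  open IsIPP ipp

  HW-efficient : ∀ y → wt y ≡ σ n → Always (Efficient (QV n ℕ.+ QP n))
                                        (interact (V n) (Pₕ n) y)
  HW-efficient y wt≡σ =
    Always-map (λ _ (acc , v≤ , p≤) → acc , ℕ.+-mono-≤ v≤ p≤) run
      (Always-zip run (Pr≥1⇒Always accepted run (ℚ.≤-reflexive (sym (completeness n n∈N y Δ≤εc))))
        (Always-zip run (V-bound n n∈N y (Pₕ n)) (P-bound n n∈N y Δ≤εc)))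
    where
    run = interact (V n) (Pₕ n) y
    Δ≤εc : Δ-HW y (σ n) ℚ≤ℝ εc
    -- Members of the weight level are at distance at most 0, so `εc` below that distance would be
    -- negative.
    Δ≤εc εc<Δ = 0≤εc (ℝ<ℚ-≤-trans εc εc<Δ (∈HW⇒Δ≤0 y wt≡σ))

  -- The two inclusions serve different ends: `HW⇒sphere` makes `x` far from the level, so that
  -- soundness applies, and `sphere⇒HW` puts every candidate at distance `w` under completeness.
  sphere-bound : ∀ x {w} → w ℕ.≤ n →
    (∀ y → wt y ≡ σ n → dist x y ≡ w) → (∀ y → dist x y ≡ w → wt y ≡ σ n) →
    εf ℝ<ℚ (ℤ.+ w / n) → n ℕ.< QV n ℕ.+ QP n ℕ.+ w
  sphere-bound x {w} w≤n HW⇒sphere sphere⇒HW εf<w/n = ℕ.≰⇒> λ room →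
    let δ , 0<δ , sound = soundness
        accepts = accepts-at-distance (V n) (Pₕ n) x room (λ y → HW-efficient y ∘ sphere⇒HW y)
    in ≤⇒≯ (ℚ.≤-trans
         (sound n n∈N x (ℝ<ℚ-≤-trans εf εf<w/n w/n≤Δ) (Pₕ n))
         (ℚ.≤-reflexive (Always⇒Pr-not≡0 accepted (interact (V n) (Pₕ n) x) accepts))) 0<δ
    where
    w/n≤1 : ℤ.+ w / n ≤ 1ℚ
    w/n≤1 = ℚ.*-cancelʳ-≤-pos (ℕ→ℚ n) (begin
      (ℤ.+ w / n) * ℕ→ℚ n  ≡⟨ /-*-cancel w n ⟩
      ℕ→ℚ w                 ≤⟨ ℕ→ℚ-mono-≤ w≤n ⟩
      ℕ→ℚ n                 ≡⟨ ℚ.*-identityˡ (ℕ→ℚ n) ⟨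
      1ℚ * ℕ→ℚ n            ∎)
      where
      open ℚ.≤-Reasoning
      instance _ = positive (ℕ→ℚ-pos n)
    w/n≤Δ : ℤ.+ w / n ≤ Δ-HW x (σ n)
    w/n≤Δ = Δ-HW-≥ x w/n≤1 (λ y wt≡σ →
      ℚ.≤-reflexive (cong (λ d → ℤ.+ d / n) (sym (HW⇒sphere y wt≡σ))))

  query-bound : ∀ {c k} → k ℕ.≤ n → σ n ≡ ℤ.+ k / n → εf ℝ<ℚ (σ n ⊔ (1ℚ - σ n)) →
                c ≤ σ n ⊓ (1ℚ - σ n) → c * ℕ→ℚ n ≤ ℕ→ℚ (QV n ℕ.+ QP n)
  query-bound {c} {k} k≤n σ≡k/n εf<max c≤min with ℚ.⊔-sel (σ n) (1ℚ - σ n)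
  -- The all-zeros string is far, with radius `k`; the gap `n - k` is the fraction `1 - σ` of `n`,
  -- at least the minimum.
  ... | inj₁ max≡σ = linear-bound n c k (QV n ℕ.+ QP n)
    (subst (λ r → c + r ≤ 1ℚ) σ≡k/n (ℚ.≤-trans
      (ℚ.+-monoˡ-≤ (σ n) (ℚ.p≤q⊓r⇒p≤r (σ n) (1ℚ - σ n) c≤min))
      (ℚ.≤-reflexive (1-p+p≡1 (σ n)))))
    (ℕ.<⇒≤ (sphere-bound (replicate n false) k≤n
      (λ y wt≡σ → trans (dist-zeros y) (/-injective n (weight y) k (trans wt≡σ σ≡k/n)))
      (λ y dist≡k → trans
        (cong (λ m → ℤ.+ m / n) (trans (sym (dist-zeros y)) dist≡k))
        (sym σ≡k/n))
      (subst (εf ℝ<ℚ_) (trans max≡σ σ≡k/n) εf<max)))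
  -- Symmetrically, the all-ones string is far, with radius `n - k`, and the gap `k` is the fraction
  -- `σ` of `n`.
  ... | inj₂ max≡1-σ = linear-bound n c (n ℕ.∸ k) (QV n ℕ.+ QP n)
    (subst (λ r → c + r ≤ 1ℚ) 1-σ≡ (ℚ.≤-trans
      (ℚ.+-monoˡ-≤ (1ℚ - σ n) (ℚ.p≤q⊓r⇒p≤q (σ n) (1ℚ - σ n) c≤min))
      (ℚ.≤-reflexive (trans (ℚ.+-comm (σ n) (1ℚ - σ n)) (1-p+p≡1 (σ n))))))
    (ℕ.<⇒≤ (sphere-bound (replicate n true) (ℕ.m∸n≤m n k)
      (λ y wt≡σ → trans (dist-ones y)
        (cong (n ℕ.∸_) (/-injective n (weight y) k (trans wt≡σ σ≡k/n))))
      (λ y dist≡n∸k → trans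
        (cong (λ m → ℤ.+ m / n) (trans (weight-ones y)
          (trans (cong (n ℕ.∸_) dist≡n∸k) (ℕ.m∸[m∸n]≡n k≤n))))
        (sym σ≡k/n))
      (subst (εf ℝ<ℚ_) (trans max≡1-σ 1-σ≡) εf<max)))
    where
    1-σ≡ : 1ℚ - σ n ≡ ℤ.+ (n ℕ.∸ k) / n
    1-σ≡ = trans (cong (λ r → 1ℚ - r) σ≡k/n) (1-/ n k≤n)

proposition3p6 : (N : Pred ℕ 0ℓ) → Unbounded N →
    (σ : ℕ → ℚ) →
    (∀ n → n ∈ N → 0ℚ < σ n × σ n < 1ℚ) →
    (λ n → σ n ⊓ (1ℚ - σ n)) ∈Ω[ N ] (λ _ → 1ℚ) →
    (∀ n → n ∈ N → ∃[ k ] k ℕ.≤ n × σ n * ℕ→ℚ n ≡ ℕ→ℚ k) →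
    (εc εf : ℝ) → 0ℚ ℚ≤ℝ εc → εc ℝ<ℝ εf → εf ℝ≤ℚ 1ℚ →
    (∀ n → n ∈ N → εf ℝ<ℚ (σ n ⊔ (1ℚ - σ n))) →
    (V : ∀ n → Verifier n) (Pₕ : ∀ n → Prover n) →
    IsIPP N σ V Pₕ εc εf →
    (QV QP : ℕ → ℕ) →
    VerifierQueryBound N V QV →
    HonestProverQueryBound N σ V Pₕ εc QP →
    ((λ n → ℕ→ℚ (QV n ℕ.+ QP n)) ∈Ω[ N ] ℕ→ℚ) ×
    ¬ (((λ n → ℕ→ℚ (QV n)) ∈o[ N ] ℕ→ℚ) × ((λ n → ℕ→ℚ (QP n)) ∈o[ N ] ℕ→ℚ))
proposition3p6 N unbounded σ _ (c , 0<c , n₀ , c≤min) σn∈ℕ εc εf 0≤εc _ _ εf<max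
               V Pₕ ipp QV QP V-bound P-bound =
  linear , λ (QV∈o , QP∈o) → not-both-sublinear QV QP unbounded linear QV∈o QP∈o
  where
  linear : (λ n → ℕ→ℚ (QV n ℕ.+ QP n)) ∈Ω[ N ] ℕ→ℚ
  linear = c , 0<c , n₀ , λ where
    -- Relative weight is undefined at length 0, but there the left side of the bound is 0.
    zero n∈N _ → ℚ.≤-trans (ℚ.≤-reflexive (ℚ.*-zeroʳ c)) (ℕ→ℚ-mono-≤ {0} {QV 0 ℕ.+ QP 0} z≤n)
    n@(suc _) n∈N n₀≤n →
      let k , k≤n , σn≡k = σn∈ℕ n n∈N
      in query-bound 0≤εc ipp V-bound P-bound n∈N k≤n (/-unique n k σn≡k) (εf<max n n∈N)
           (subst (_≤ σ n ⊓ (1ℚ - σ n)) (ℚ.*-identityʳ c) (c≤min n n∈N n₀≤n))
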